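{- Every ice fork with exactly two frozen vertices is a brog quiver.
   Context: Quiver: finite directed graph without loops or oriented 2-cycles, vertices partitioned into mutable and frozen, arrows between frozen vertices ignored; $b_{ij}$ = #arrows $i\to j$ − #arrows $j\to i$. Abundant: at least 2 arrows between every pair of vertices at least one mutable. A fork is an abundant, non-acyclic quiver with at most one frozen vertex and a vertex $r$ (point of return) such that $b_{ij}>b_{ri}$ and $b_{ij}>b_{jr}$ whenever $r\to i$ and $j\to r$, and the subquivers induced on $\{i:r\to i\}$ and $\{j:j\to r\}$ are acyclic. A quiver with mutable vertices $[n]$ and frozen $u_1,\dots,u_m$ ($m\ge1$) is an ice fork with point of return $r$ if each $Q|_{[n]\cup\{u_i\}}$ is a fork with point of return $r$. A mutable vertex adjacent to a frozen vertex is red (green) if all arrows between it and frozen vertices point toward (away from) it. Mutable $i,j$ are complementary if for every frozen $u$ with $b_{iu},b_{ju}$ both nonzero they have opposite signs. A quiver is brog if its mutable vertices can be colored blue, red, orange, green so that: red-colored = red vertices; green-colored = green vertices; each blue $i$ has $b_{ij}\ge0$ for red $j$ and $b_{ij}\le0$ for green $j$; each orange $i$ has $b_{ij}\ge0$ for green $j$ and $b_{ij}\le0$ for red $j$; each blue vertex is complementary to each orange vertex. -}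

module Defs where

open import Data.Nat as ℕ using (ℕ; suc)
open import Data.Fin using (Fin)
open import Data.Integer as ℤ using (ℤ; 0ℤ; -_; ∣_∣)
open import Data.Sum using (_⊎_; inj₁; inj₂)
open import Data.Product using (Σ; ∃; ∃-syntax; _×_; _,_)
open import Data.Empty using (⊥)
open import Data.Unit using (⊤)
open import Relation.Nullary using (¬_)
open import Relation.Binary.PropositionalEquality using (_≡_; _≢_)
open import Relation.Binary.Construct.Closure.Transitive using (TransClosure)
open import Function.Bundles using (_⇔_)

-- Vertices of a quiver with mutable vertices Fin n (= [n]) and frozen
-- vertices Fin m (= u_1, ..., u_m).
Vertex : ℕ → ℕ → Set
Vertex n m = Fin n ⊎ Fin m

IsFrozen : ∀ {n m} → Vertex n m → Set
IsFrozen (inj₁ _) = ⊥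
IsFrozen (inj₂ _) = ⊤

-- A quiver without loops and oriented 2-cycles is determined by its
-- skew-symmetric matrix b_ij = #(i → j) - #(j → i).  (Entries between two
-- frozen vertices are carried along but ignored everywhere below.)
record Quiver (n m : ℕ) : Set where
  field
    b    : Vertex n m → Vertex n m → ℤ
    skew : ∀ x y → b x y ≡ - b y x
open Quiver public

module _ {n m : ℕ} (Q : Quiver n m) where

  -- there is (at least one) arrow x → y, frozen–frozen arrows ignored
  Arrow : Vertex n m → Vertex n m → Set
  Arrow x y = ¬ (IsFrozen x × IsFrozen y) × (0ℤ ℤ.< b Q x y)

  -- abundant: at least 2 arrows between every pair of distinct vertices
  -- at least one of which is mutable
  Abundant : Set
  Abundant = ∀ x y → x ≢ y → ¬ (IsFrozen x × IsFrozen y) → 2 ℕ.≤ ∣ b Q x y ∣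

  -- the full subquiver induced on {x | P x} is acyclic: no oriented cycle
  -- (closed walk of positive length) inside it
  AcyclicOn : (Vertex n m → Set) → Set
  AcyclicOn P = ∀ x → ¬ TransClosure (λ y z → P y × P z × Arrow y z) x x

  Acyclic : Set
  Acyclic = ∀ x → ¬ TransClosure Arrow x x

  -- fork with point of return r
  IsForkWithReturn : Vertex n m → Set
  IsForkWithReturn r =
    (m ℕ.≤ 1) × Abundant × (¬ Acyclic) ×
    (∀ i j → Arrow r i → Arrow j r →
       (b Q r i ℤ.< b Q i j) × (b Q j r ℤ.< b Q i j)) ×
    AcyclicOn (λ i → Arrow r i) ×
    AcyclicOn (λ j → Arrow j r)

  IsFork : Set
  IsFork = ∃[ r ] IsForkWithReturn r

-- Q|_{[n] ∪ {u}} : the full subquiver on the mutable vertices and one frozen u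
restrictFrozen : ∀ {n m} → Quiver n m → Fin m → Quiver n 1
restrictFrozen {n} {m} Q u = record { b = λ x y → b Q (emb x) (emb y) ; skew = λ x y → skew Q (emb x) (emb y) }
  where
  emb : Vertex n 1 → Vertex n m
  emb (inj₁ i) = inj₁ i
  emb (inj₂ _) = inj₂ u

-- ice fork with point of return r (r mutable, since it is common to all the
-- restrictions); requires m ≥ 1
IsIceForkWithReturn : ∀ {n m} → Quiver n m → Fin n → Set
IsIceForkWithReturn {n} {m} Q r =
  (1 ℕ.≤ m) × (∀ u → IsForkWithReturn (restrictFrozen Q u) (inj₁ r))

IsIceFork : ∀ {n m} → Quiver n m → Set
IsIceFork {n} Q = ∃[ r ] IsIceForkWithReturn Q r

module _ {n m : ℕ} (Q : Quiver n m) where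

  -- mutable i adjacent to some frozen vertex
  AdjFrozen : Fin n → Set
  AdjFrozen i = ∃[ u ] b Q (inj₁ i) (inj₂ u) ≢ 0ℤ

  -- red: all arrows between i and frozen vertices point toward i
  Red : Fin n → Set
  Red i = AdjFrozen i × (∀ u → b Q (inj₁ i) (inj₂ u) ℤ.≤ 0ℤ)

  -- green: all arrows between i and frozen vertices point away from i
  Green : Fin n → Set
  Green i = AdjFrozen i × (∀ u → 0ℤ ℤ.≤ b Q (inj₁ i) (inj₂ u))

  -- complementary mutable vertices
  Complementary : Fin n → Fin n → Set
  Complementary i j = ∀ u → b Q (inj₁ i) (inj₂ u) ≢ 0ℤ → b Q (inj₁ j) (inj₂ u) ≢ 0ℤ →
    b Q (inj₁ i) (inj₂ u) ℤ.* b Q (inj₁ j) (inj₂ u) ℤ.< 0ℤ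

data Colour : Set where
  blue red orange green : Colour

IsBrogColouring : ∀ {n m} → Quiver n m → (Fin n → Colour) → Set
IsBrogColouring {n} Q c =
  (∀ i → (c i ≡ red) ⇔ Red Q i) ×
  (∀ i → (c i ≡ green) ⇔ Green Q i) ×
  (∀ i → c i ≡ blue → (∀ j → c j ≡ red → 0ℤ ℤ.≤ b Q (inj₁ i) (inj₁ j))
                     × (∀ j → c j ≡ green → b Q (inj₁ i) (inj₁ j) ℤ.≤ 0ℤ)) ×
  (∀ i → c i ≡ orange → (∀ j → c j ≡ green → 0ℤ ℤ.≤ b Q (inj₁ i) (inj₁ j))
                       × (∀ j → c j ≡ red → b Q (inj₁ i) (inj₁ j) ℤ.≤ 0ℤ)) ×
  (∀ i j → c i ≡ blue → c j ≡ orange → Complementary Q i j)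

IsBrog : ∀ {n m} → Quiver n m → Set
IsBrog Q = ∃[ c ] IsBrogColouring Q c

{-# OPTIONS --safe #-}

-- Colour a mutable vertex red or green when its arrows to the frozen vertices
-- all point in (resp. out), and otherwise orange if it is the point of return r
-- and blue if not.  Two facts about a fork with point of return r do the work,
-- applied to each restriction to a single frozen vertex u.  First, every
-- out-neighbour of r has an arrow to every in-neighbour; read on signs, if u
-- and i lie on opposite sides of r then the arrow between i and u points the
-- way the arrow between r and i does.  This locates red and green vertices
-- relative to r, and forces a mixed i ≠ r to carry the sign pattern opposite to
-- that of r, which with exactly two frozen vertices is complementarity.
-- Second, no oriented triangle avoids r: it would lie inside one acyclic
-- neighbourhood of r or contain an arrow from an in- to an out-neighbour.  A
-- path i → u → j between blue and red (or green and blue) vertices therefore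
-- forbids the arrow j → i.

module Submission where

open import Defs
open import Data.Nat as ℕ using (ℕ; suc)
open import Data.Fin using (Fin; zero; suc; _≟_)
open import Data.Fin.Properties using (all?; ¬∀⟶∃¬)
open import Data.Integer as ℤ using (0ℤ; +_; +[1+_]; -[1+_]; sign; _<_; _≤_; _*_)
import Data.Integer.Properties as ℤ
open import Data.Sign as Sign using (Sign; opposite)
open import Data.Sign.Properties using (s≢opposite[s]; opposite-injective)
open import Data.Sum using (_⊎_; inj₁; inj₂)
open import Data.Sum.Properties using (inj₁-injective)
open import Data.Product using (∃-syntax; _×_; _,_; proj₁; proj₂)
open import Data.Empty using (⊥; ⊥-elim)
open import Function using (_∘_)
open import Function.Bundles using (_⇔_; mk⇔; Equivalence)
open import Function.Construct.Composition using (_⇔-∘_)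
open import Function.Definitions using (StrictlySurjective)
open import Relation.Nullary using (¬_; Dec; yes; no)
open import Relation.Binary.PropositionalEquality using (_≡_; _≢_; refl; sym; trans; subst; cong)
open import Relation.Binary.Construct.Closure.Transitive using ([_]; _∷_)

≢⇒≡opposite : ∀ {s t : Sign} → s ≢ t → s ≡ opposite t
≢⇒≡opposite {Sign.-} {Sign.-} s≢t = ⊥-elim (s≢t refl)
≢⇒≡opposite {Sign.-} {Sign.+} _   = refl
≢⇒≡opposite {Sign.+} {Sign.-} _   = refl
≢⇒≡opposite {Sign.+} {Sign.+} s≢t = ⊥-elim (s≢t refl)

sign≡-⇒<0 : ∀ {x} → sign x ≡ Sign.- → x < 0ℤ
sign≡-⇒<0 { -[1+ _ ]} _ = ℤ.-<+

sign≡+⇒≥0 : ∀ {x} → sign x ≡ Sign.+ → 0ℤ ≤ x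
sign≡+⇒≥0 {+ _} _ = ℤ.+≤+ ℕ.z≤n

sign≡+⇒>0 : ∀ {x} → x ≢ 0ℤ → sign x ≡ Sign.+ → 0ℤ < x
sign≡+⇒>0 {+ 0}      x≢0 _ = ⊥-elim (x≢0 refl)
sign≡+⇒>0 {+[1+ _ ]} _   _ = ℤ.+<+ (ℕ.s≤s ℕ.z≤n)

≥0⇒sign≡+ : ∀ {x} → 0ℤ ≤ x → sign x ≡ Sign.+
≥0⇒sign≡+ {+ _} _ = refl

<0⇒sign≡- : ∀ {x} → x < 0ℤ → sign x ≡ Sign.-
<0⇒sign≡- {+ _}       (ℤ.+<+ ())
<0⇒sign≡- { -[1+ _ ]} _ = refl

≤0⇒sign≡- : ∀ {x} → x ≢ 0ℤ → x ≤ 0ℤ → sign x ≡ Sign.-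
≤0⇒sign≡- {+ 0}       x≢0 _ = ⊥-elim (x≢0 refl)
≤0⇒sign≡- {+[1+ _ ]}  _   (ℤ.+≤+ ())
≤0⇒sign≡- { -[1+ _ ]} _   _ = refl

sign-≢⇒*<0 : ∀ {x y} → x ≢ 0ℤ → y ≢ 0ℤ → sign x ≢ sign y → x * y < 0ℤ
sign-≢⇒*<0 {+ 0}       x≢0 _   _  = ⊥-elim (x≢0 refl)
sign-≢⇒*<0 {_} {+ 0}   _   y≢0 _  = ⊥-elim (y≢0 refl)
sign-≢⇒*<0 {+[1+ _ ]}  {+[1+ _ ]}  _ _ s≢s = ⊥-elim (s≢s refl)
sign-≢⇒*<0 {+[1+ _ ]}  { -[1+ _ ]} _ _ _   = ℤ.-<+
sign-≢⇒*<0 { -[1+ _ ]} {+[1+ _ ]}  _ _ _   = ℤ.-<+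
sign-≢⇒*<0 { -[1+ _ ]} { -[1+ _ ]} _ _ s≢s = ⊥-elim (s≢s refl)

Constant : ∀ {A : Set} → Sign → (A → Sign) → Set
Constant s f = ∀ a → f a ≡ s

surjective⇒¬constant : ∀ {A : Set} {f : A → Sign} {s} →
                       StrictlySurjective _≡_ f → ¬ Constant s f
surjective⇒¬constant {s = s} surj const =
  let (a , fa≡-s) = surj (opposite s) in s≢opposite[s] s (trans (sym (const a)) fa≡-s)

SignPattern : ∀ {A : Set} → (A → Sign) → Set
SignPattern f = (∃[ s ] Constant s f) ⊎ StrictlySurjective _≡_ f

signPattern : ∀ {k} (f : Fin (suc k) → Sign) → SignPattern f
signPattern {k} f with all? (λ a → f a Sign.≟ f zero)
... | yes const = inj₁ (f zero , const)
... | no ¬const = inj₂ surj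
  where
  surj : StrictlySurjective _≡_ f
  surj s with s Sign.≟ f zero | ¬∀⟶∃¬ (suc k) _ (λ a → f a Sign.≟ f zero) ¬const
  ... | yes s≡f0 | _          = zero , sym s≡f0
  ... | no s≢f0  | a , fa≢f0  = a , trans (≢⇒≡opposite fa≢f0) (sym (≢⇒≡opposite s≢f0))

surjective⇒swap : ∀ {f : Fin 2 → Sign} → StrictlySurjective _≡_ f →
                  f (suc zero) ≡ opposite (f zero)
surjective⇒swap surj = ≢⇒≡opposite λ f1≡f0 →
  surjective⇒¬constant surj λ { zero → refl ; (suc zero) → f1≡f0 }

surjective-agree-everywhere : ∀ {f g : Fin 2 → Sign} →
  StrictlySurjective _≡_ f → StrictlySurjective _≡_ g →
  ∀ {v} → f v ≡ g v → ∀ w → f w ≡ g w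
surjective-agree-everywhere {f} {g} sf sg {v} fv≡gv = agree
  where
  agree-at-zero : ∀ v → f v ≡ g v → f zero ≡ g zero
  agree-at-zero zero       e = e
  agree-at-zero (suc zero) e =
    opposite-injective (trans (sym (surjective⇒swap sf)) (trans e (surjective⇒swap sg)))
  agree : ∀ w → f w ≡ g w
  agree zero       = agree-at-zero v fv≡gv
  agree (suc zero) = trans (surjective⇒swap sf)
                       (trans (cong opposite (agree zero)) (sym (surjective⇒swap sg)))

signColour : Sign → Colour
signColour Sign.- = red
signColour Sign.+ = green

signColour-injective : ∀ {s t} → signColour s ≡ signColour t → s ≡ t
signColour-injective {Sign.-} {Sign.-} _ = refl
signColour-injective {Sign.+} {Sign.+} _ = refl

-- The decision records whether the vertex is the point of return.
colour : ∀ {A P : Set} {f : A → Sign} → SignPattern f → Dec P → Colour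
colour (inj₁ (s , _)) _       = signColour s
colour (inj₂ _)       (yes _) = orange
colour (inj₂ _)       (no _)  = blue

module _ {k} {P : Set} {f : Fin (suc k) → Sign} where

  colour≡signColour⇔constant : (p : SignPattern f) (d : Dec P) (s : Sign) →
                               (colour p d ≡ signColour s) ⇔ Constant s f
  colour≡signColour⇔constant p d s = mk⇔ (to p d s) (from p)
    where
    to : ∀ p d s → colour p d ≡ signColour s → Constant s f
    to (inj₁ (_ , const)) _ _ e a = trans (const a) (signColour-injective e)
    to (inj₂ _) (yes _) Sign.- ()
    to (inj₂ _) (yes _) Sign.+ ()
    to (inj₂ _) (no _)  Sign.- ()
    to (inj₂ _) (no _)  Sign.+ ()
    from : ∀ p → Constant s f → colour p d ≡ signColour s
    from (inj₁ (_ , const)) const′ = cong signColour (trans (sym (const zero)) (const′ zero))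
    from (inj₂ surj)        const′ = ⊥-elim (surjective⇒¬constant surj const′)

  colour≡orange : (p : SignPattern f) (d : Dec P) →
                  colour p d ≡ orange → StrictlySurjective _≡_ f × P
  colour≡orange (inj₁ (Sign.- , _)) _ ()
  colour≡orange (inj₁ (Sign.+ , _)) _ ()
  colour≡orange (inj₂ surj) (yes x) _ = surj , x

  colour≡blue : (p : SignPattern f) (d : Dec P) →
                colour p d ≡ blue → StrictlySurjective _≡_ f × ¬ P
  colour≡blue (inj₁ (Sign.- , _)) _ ()
  colour≡blue (inj₁ (Sign.+ , _)) _ ()
  colour≡blue (inj₂ surj) (no ¬x) _ = surj , ¬x

frozenSign : ∀ {n m} → Quiver n m → Fin n → Fin m → Sign
frozenSign Q i u = sign (b Q (inj₁ i) (inj₂ u))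

module _ {n m} (Q : Quiver n m) where

  abundant⇒≢0 : Abundant Q → ∀ {x y} → x ≢ y → ¬ (IsFrozen x × IsFrozen y) → b Q x y ≢ 0ℤ
  abundant⇒≢0 abundant x≢y mutable bxy≡0 with abundant _ _ x≢y mutable
  ... | 2≤∣bxy∣ rewrite bxy≡0 with () ← 2≤∣bxy∣

  >0⇒reverse-<0 : ∀ {x y} → 0ℤ < b Q x y → b Q y x < 0ℤ
  >0⇒reverse-<0 {x} {y} p = subst (_< 0ℤ) (sym (skew Q y x)) (ℤ.neg-mono-< p)

  <0⇒reverse->0 : ∀ {x y} → b Q x y < 0ℤ → 0ℤ < b Q y x
  <0⇒reverse->0 {x} {y} p = subst (0ℤ <_) (sym (skew Q y x)) (ℤ.neg-mono-< p)

  ≤0⇒reverse-≥0 : ∀ {x y} → b Q x y ≤ 0ℤ → 0ℤ ≤ b Q y x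
  ≤0⇒reverse-≥0 {x} {y} p = subst (0ℤ ≤_) (sym (skew Q y x)) (ℤ.neg-mono-≤ p)

  ≥0⇒reverse-≤0 : ∀ {x y} → 0ℤ ≤ b Q x y → b Q y x ≤ 0ℤ
  ≥0⇒reverse-≤0 {x} {y} p = subst (_≤ 0ℤ) (sym (skew Q y x)) (ℤ.neg-mono-≤ p)

  sign≡+⇒arrow : ∀ {x y} → ¬ (IsFrozen x × IsFrozen y) → b Q x y ≢ 0ℤ →
                 sign (b Q x y) ≡ Sign.+ → Arrow Q x y
  sign≡+⇒arrow mutable bxy≢0 s = mutable , sign≡+⇒>0 bxy≢0 s

  sign≡-⇒arrow : ∀ {x y} → ¬ (IsFrozen x × IsFrozen y) →
                 sign (b Q x y) ≡ Sign.- → Arrow Q y x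
  sign≡-⇒arrow mutable s = (λ (fy , fx) → mutable (fx , fy)) , <0⇒reverse->0 (sign≡-⇒<0 s)

module Fork {n m} (Q : Quiver n m) (r : Fin n) (fork : IsForkWithReturn Q (inj₁ r)) where

  -- `proj₁` refutes `IsFrozen (inj₁ _) × _`, as `IsFrozen (inj₁ _)` is ⊥.
  private
    ρ : Vertex n m
    ρ = inj₁ r

    abundant : Abundant Q
    abundant = let (_ , a , _) = fork in a

    wedge : ∀ x y → Arrow Q ρ x → Arrow Q y ρ → (b Q ρ x < b Q x y) × (b Q y ρ < b Q x y)
    wedge = let (_ , _ , _ , w , _) = fork in w

    out-acyclic : AcyclicOn Q (Arrow Q ρ)
    out-acyclic = let (_ , _ , _ , _ , o , _) = fork in o

    in-acyclic : AcyclicOn Q (λ x → Arrow Q x ρ)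
    in-acyclic = let (_ , _ , _ , _ , _ , i) = fork in i

  joined-to-return : ∀ {x} → x ≢ ρ → b Q ρ x ≢ 0ℤ
  joined-to-return x≢ρ = abundant⇒≢0 Q abundant (x≢ρ ∘ sym) proj₁

  side : ∀ {x} → x ≢ ρ → Arrow Q ρ x ⊎ Arrow Q x ρ
  side {x} x≢ρ with sign (b Q ρ x) in s
  ... | Sign.+ = inj₁ (sign≡+⇒arrow Q proj₁ (joined-to-return x≢ρ) s)
  ... | Sign.- = inj₂ (sign≡-⇒arrow Q proj₁ s)

  out→in : ∀ {x y} → Arrow Q ρ x → Arrow Q y ρ → 0ℤ < b Q x y
  out→in {x} {y} ρx yρ = ℤ.<-trans (proj₂ ρx) (proj₁ (wedge x y ρx yρ))

  no-triangle-avoiding-return : ∀ {x y z} → x ≢ ρ → y ≢ ρ → z ≢ ρ →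
                                Arrow Q x y → Arrow Q y z → Arrow Q z x → ⊥
  no-triangle-avoiding-return {x} {y} {z} x≢ρ y≢ρ z≢ρ xy yz zx =
    go (side x≢ρ) (side y≢ρ) (side z≢ρ)
    where
    in→out-impossible : ∀ {v w} → Arrow Q v ρ → Arrow Q ρ w → ¬ Arrow Q v w
    in→out-impossible vρ ρw vw = ℤ.<-asym (proj₂ vw) (>0⇒reverse-<0 Q (out→in ρw vρ))
    go : Arrow Q ρ x ⊎ Arrow Q x ρ → Arrow Q ρ y ⊎ Arrow Q y ρ → Arrow Q ρ z ⊎ Arrow Q z ρ → ⊥
    go (inj₁ ρx) (inj₁ ρy) (inj₁ ρz) =
      out-acyclic x ((ρx , ρy , xy) ∷ (ρy , ρz , yz) ∷ [ ρz , ρx , zx ])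
    go (inj₂ xρ) (inj₂ yρ) (inj₂ zρ) =
      in-acyclic x ((xρ , yρ , xy) ∷ (yρ , zρ , yz) ∷ [ zρ , xρ , zx ])
    go _         (inj₂ yρ) (inj₁ ρz) = in→out-impossible yρ ρz yz
    go (inj₂ xρ) (inj₁ ρy) _         = in→out-impossible xρ ρy xy
    go (inj₁ ρx) (inj₁ _)  (inj₂ zρ) = in→out-impossible zρ ρx zx
    go (inj₁ ρx) (inj₂ _)  (inj₂ zρ) = in→out-impossible zρ ρx zx

  sign-across-return : ∀ {x y} → x ≢ ρ → y ≢ ρ →
                       sign (b Q ρ y) ≡ opposite (sign (b Q ρ x)) → sign (b Q x y) ≡ sign (b Q ρ x)
  sign-across-return {x} {y} x≢ρ y≢ρ opp with sign (b Q ρ x) in s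
  ... | Sign.+ = ≥0⇒sign≡+ (ℤ.<⇒≤ (out→in (sign≡+⇒arrow Q proj₁ (joined-to-return x≢ρ) s)
                                           (sign≡-⇒arrow Q proj₁ opp)))
  ... | Sign.- = <0⇒sign≡- (>0⇒reverse-<0 Q (out→in (sign≡+⇒arrow Q proj₁ (joined-to-return y≢ρ) opp)
                                                   (sign≡-⇒arrow Q proj₁ s)))

module _ {n m} (Q : Quiver n (suc m)) {i : Fin n} (b≢0 : ∀ u → b Q (inj₁ i) (inj₂ u) ≢ 0ℤ) where

  constant⇔red : Constant Sign.- (frozenSign Q i) ⇔ Red Q i
  constant⇔red = mk⇔ (λ const → (zero , b≢0 zero) , λ u → ℤ.<⇒≤ (sign≡-⇒<0 (const u)))
                     (λ (_ , ≤0) u → ≤0⇒sign≡- (b≢0 u) (≤0 u))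

  constant⇔green : Constant Sign.+ (frozenSign Q i) ⇔ Green Q i
  constant⇔green = mk⇔ (λ const → (zero , b≢0 zero) , λ u → sign≡+⇒≥0 (const u))
                       (λ (_ , ≥0) u → ≥0⇒sign≡+ (≥0 u))

module IceFork {n m} (Q : Quiver n (suc m)) (r : Fin n)
               (ice : ∀ u → IsForkWithReturn (restrictFrozen Q u) (inj₁ r)) where

  direction : Fin n → Sign
  direction i = sign (b Q (inj₁ r) (inj₁ i))

  private
    module R u = Fork (restrictFrozen Q u) r (ice u)

    mutable≢return : ∀ {i} → i ≢ r → _≡_ {A = Vertex n 1} (inj₁ i) (inj₁ r) → ⊥
    mutable≢return i≢r = i≢r ∘ inj₁-injective

  frozen-≢0 : ∀ i u → b Q (inj₁ i) (inj₂ u) ≢ 0ℤ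
  frozen-≢0 i u = let (_ , abundant , _) = ice u in
    abundant⇒≢0 (restrictFrozen Q u) abundant {inj₁ i} {inj₂ zero} (λ ()) proj₁

  frozenSign-across-return : ∀ {i u} → i ≢ r →
    frozenSign Q r u ≡ opposite (direction i) → frozenSign Q i u ≡ direction i
  frozenSign-across-return {u = u} i≢r =
    R.sign-across-return u {y = inj₂ zero} (mutable≢return i≢r) (λ ())

  ≥0-through-frozen : ∀ {i j u} → i ≢ r → j ≢ r →
    frozenSign Q i u ≡ Sign.+ → frozenSign Q j u ≡ Sign.- → 0ℤ ≤ b Q (inj₁ i) (inj₁ j)
  ≥0-through-frozen {i} {j} {u} i≢r j≢r iu ju = ≤0⇒reverse-≥0 Q (ℤ.≮⇒≥ λ ji →
    R.no-triangle-avoiding-return u {y = inj₂ zero} (mutable≢return i≢r) (λ ()) (mutable≢return j≢r)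
      (sign≡+⇒arrow (restrictFrozen Q u) {inj₁ i} {inj₂ zero} proj₁ (frozen-≢0 i u) iu)
      (sign≡-⇒arrow (restrictFrozen Q u) {inj₁ j} {inj₂ zero} proj₁ ju) (proj₁ , ji))

  direction-of-constant : ∀ {j s} → StrictlySurjective _≡_ (frozenSign Q r) →
    Constant s (frozenSign Q j) → direction j ≡ s
  direction-of-constant {j} surj const =
    let (u , ru) = surj (opposite (direction j)) in
    trans (sym (frozenSign-across-return j≢r ru)) (const u)
    where
    j≢r : j ≢ r
    j≢r refl = surjective⇒¬constant surj const

  direction-to-constant-return : ∀ {i s} → Constant s (frozenSign Q r) → i ≢ r →
    StrictlySurjective _≡_ (frozenSign Q i) → direction i ≡ s
  direction-to-constant-return {i} {s} const i≢r surj with direction i Sign.≟ s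
  ... | yes d≡s = d≡s
  ... | no d≢s = ⊥-elim (surjective⇒¬constant surj λ u →
    frozenSign-across-return i≢r (trans (const u) (≢⇒≡opposite (d≢s ∘ sym))))

  differs-from-return : ∀ {i} → i ≢ r → StrictlySurjective _≡_ (frozenSign Q r) →
    ∃[ u ] frozenSign Q i u ≢ frozenSign Q r u
  differs-from-return {i} i≢r surj =
    let (u , ru) = surj (opposite (direction i)) in
    u , λ same → s≢opposite[s] (direction i)
                   (trans (sym (frozenSign-across-return i≢r ru)) (trans same ru))

  colouring : Fin n → Colour
  colouring i = colour (signPattern (frozenSign Q i)) (i ≟ r)

  colouring≡signColour⇔constant : ∀ i s →
    (colouring i ≡ signColour s) ⇔ Constant s (frozenSign Q i)
  colouring≡signColour⇔constant i =
    colour≡signColour⇔constant (signPattern (frozenSign Q i)) (i ≟ r)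

  colouring-constant : ∀ {i} s → colouring i ≡ signColour s → Constant s (frozenSign Q i)
  colouring-constant {i} s = Equivalence.to (colouring≡signColour⇔constant i s)

  colouring≡blue : ∀ {i} → colouring i ≡ blue → StrictlySurjective _≡_ (frozenSign Q i) × i ≢ r
  colouring≡blue {i} = colour≡blue (signPattern (frozenSign Q i)) (i ≟ r)

  colouring≡orange : ∀ {i} → colouring i ≡ orange → StrictlySurjective _≡_ (frozenSign Q i) × i ≡ r
  colouring≡orange {i} = colour≡orange (signPattern (frozenSign Q i)) (i ≟ r)

  red-iff : ∀ i → (colouring i ≡ red) ⇔ Red Q i
  red-iff i = constant⇔red Q (frozen-≢0 i) ⇔-∘ colouring≡signColour⇔constant i Sign.-

  green-iff : ∀ i → (colouring i ≡ green) ⇔ Green Q i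
  green-iff i = constant⇔green Q (frozen-≢0 i) ⇔-∘ colouring≡signColour⇔constant i Sign.+

  blue-conditions : ∀ i → colouring i ≡ blue →
    (∀ j → colouring j ≡ red → 0ℤ ≤ b Q (inj₁ i) (inj₁ j)) ×
    (∀ j → colouring j ≡ green → b Q (inj₁ i) (inj₁ j) ≤ 0ℤ)
  blue-conditions i ci with colouring≡blue ci
  ... | surj , i≢r = toward-red , away-from-green
    where
    toward-red : ∀ j → colouring j ≡ red → 0ℤ ≤ b Q (inj₁ i) (inj₁ j)
    toward-red j cj with colouring-constant Sign.- cj | j ≟ r
    ... | const | yes refl =
      ≤0⇒reverse-≥0 Q (ℤ.<⇒≤ (sign≡-⇒<0 (direction-to-constant-return const i≢r surj)))
    ... | const | no j≢r   =
      let (u , iu) = surj Sign.+ in ≥0-through-frozen i≢r j≢r iu (const u)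
    away-from-green : ∀ j → colouring j ≡ green → b Q (inj₁ i) (inj₁ j) ≤ 0ℤ
    away-from-green j cj with colouring-constant Sign.+ cj | j ≟ r
    ... | const | yes refl =
      ≥0⇒reverse-≤0 Q (sign≡+⇒≥0 (direction-to-constant-return const i≢r surj))
    ... | const | no j≢r   =
      let (u , iu) = surj Sign.- in ≥0⇒reverse-≤0 Q (≥0-through-frozen j≢r i≢r (const u) iu)

  orange-conditions : ∀ i → colouring i ≡ orange →
    (∀ j → colouring j ≡ green → 0ℤ ≤ b Q (inj₁ i) (inj₁ j)) ×
    (∀ j → colouring j ≡ red → b Q (inj₁ i) (inj₁ j) ≤ 0ℤ)
  orange-conditions i ci with colouring≡orange ci
  ... | surj , refl =
    (λ j cj → sign≡+⇒≥0 (direction-of-constant surj (colouring-constant Sign.+ cj))) ,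
    (λ j cj → ℤ.<⇒≤ (sign≡-⇒<0 (direction-of-constant surj (colouring-constant Sign.- cj))))

module _ {n} (Q : Quiver n 2) (r : Fin n)
         (ice : ∀ u → IsForkWithReturn (restrictFrozen Q u) (inj₁ r)) where

  open IceFork Q r ice

  blue-orange-complementary : ∀ i j → colouring i ≡ blue → colouring j ≡ orange →
                              Complementary Q i j
  blue-orange-complementary i j ci cj with colouring≡blue ci | colouring≡orange cj
  ... | surj-i , i≢r | surj-r , refl =
    let (u , differ) = differs-from-return i≢r surj-r in
    λ v bi≢0 br≢0 → sign-≢⇒*<0 bi≢0 br≢0 λ same →
      differ (surjective-agree-everywhere surj-i surj-r same u)

proposition5p5 : (n : ℕ) (Q : Quiver n 2) → IsIceFork Q → IsBrog Q
proposition5p5 n Q (r , _ , ice) =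
  colouring , red-iff , green-iff , blue-conditions , orange-conditions ,
  blue-orange-complementary Q r ice
  where open IceFork Q r ice
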